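{- Let $H_0$ be a Horton set of $n$ points and let $2\le l<k\le n$ be integers. Then the diameter of $IJ(H_0,k,l)$ is $\Omega\!\left(\frac{\log n-\log k}{\log(k-l)}\right)$.
   Context: Point sets $X,Y$ in the plane: $X$ is high above $Y$ if no line through two points of $X\cup Y$ is vertical, every line through two points of $X$ lies above all points of $Y$, and every line through two points of $Y$ lies below all points of $X$. For a finite set $H_s$ with distinct $x$-coordinates, indexed by increasing $x$-coordinate, $H_{s0}$ consists of its even-indexed points and $H_{s1}$ of its odd-indexed points ($s$ a binary string; the whole set is $H_0$). A finite set $H_0$ with no two points sharing an $x$-coordinate is a Horton set if $|H_0|\le1$, or $H_{00}$ and $H_{01}$ are Horton sets (recursively) and $H_{00}$ is high above $H_{01}$. An island of $H_0$ is a set $H_0\cap C$ with $C$ convex; $IJ(H_0,k,l)$ is the graph whose vertices are the $k$-element islands, two adjacent if their intersection has exactly $l$ elements. The diameter is the maximum graph distance between two vertices; the implied constant is absolute.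
   Formalization: The points of the Horton set have rational rather than real coordinates (and convex sets are taken in the rational plane); log(k−l) is read as log max(2, k−l), since it vanishes for k−l = 1. -}

module Defs where

open import Level using (0ℓ)
open import Data.Nat as ℕ using (ℕ; zero; suc; _⊔_)
open import Data.Rational as ℚ using (ℚ; 0ℚ; 1ℚ; _+_; _*_; _-_)
open import Data.Product using (Σ; _×_; _,_; proj₁; proj₂)
open import Data.List using (List; []; _∷_; length; lookup; _++_)
open import Data.List.Membership.Propositional using (_∈_)
open import Data.Fin using (Fin; toℕ)
open import Data.Fin.Subset as Sub using (Subset; _∩_; ∣_∣)
open import Relation.Binary.PropositionalEquality using (_≡_; _≢_)

Point : Set
Point = ℚ × ℚ

xc : Point → ℚ
xc = proj₁

yc : Point → ℚ
yc = proj₂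

-- A finite point set with pairwise distinct x-coordinates, given as the list
-- of its points in order of strictly increasing x-coordinate (index 0 first).
StrictlyIncX : List Point → Set
StrictlyIncX H = ∀ (i j : Fin (length H)) → toℕ i ℕ.< toℕ j →
  xc (lookup H i) ℚ.< xc (lookup H j)

evens odds : List Point → List Point
evens []       = []
evens (p ∷ ps) = p ∷ odds ps
odds  []       = []
odds  (p ∷ ps) = evens ps

-- For p, q with xc p < xc q:
--  lineMinus r p q = (value at xc r of the line through p,q  −  yc r) · (xc q − xc p)
-- so r lies strictly below the line pq iff this is > 0, strictly above iff < 0.
lineMinus : Point → Point → Point → ℚ
lineMinus r p q = (yc p - yc r) * (xc q - xc p) + (yc q - yc p) * (xc r - xc p)

HighAbove : List Point → List Point → Set
HighAbove X Y =
  (∀ p q → p ∈ X ++ Y → q ∈ X ++ Y → p ≢ q → xc p ≢ xc q)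
  × (∀ p q r → p ∈ X → q ∈ X → r ∈ Y → xc p ℚ.< xc q → 0ℚ ℚ.< lineMinus r p q)
  × (∀ p q r → p ∈ Y → q ∈ Y → r ∈ X → xc p ℚ.< xc q → lineMinus r p q ℚ.< 0ℚ)

-- Horton sets (for a list sorted by increasing x-coordinate):
-- H₀ is Horton if |H₀| ≤ 1, or H₀₀ (even-indexed) and H₀₁ (odd-indexed)
-- are Horton and H₀₀ is high above H₀₁.
data Horton : List Point → Set where
  small : ∀ {H} → length H ℕ.≤ 1 → Horton H
  split : ∀ {H} → Horton (evens H) → Horton (odds H) →
          HighAbove (evens H) (odds H) → Horton H

_·_ : ℚ → Point → Point
t · (a , b) = (t * a , t * b)

_⊕_ : Point → Point → Point
(a , b) ⊕ (c , d) = (a + c , b + d)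

Convex : (Point → Set) → Set
Convex C = ∀ p q t → 0ℚ ℚ.≤ t → t ℚ.≤ 1ℚ → C p → C q →
  C ((t · p) ⊕ ((1ℚ - t) · q))

Island : (H : List Point) → Subset (length H) → Set₁
Island H S = Σ (Point → Set) λ C → Convex C ×
  (∀ i → (i Sub.∈ S → C (lookup H i)) × (C (lookup H i) → i Sub.∈ S))

Vertex : (H : List Point) → ℕ → Subset (length H) → Set₁
Vertex H k S = Island H S × ∣ S ∣ ≡ k

data Walk (H : List Point) (k l : ℕ) : ℕ → Subset (length H) → Subset (length H) → Set₁ where
  here : ∀ {A} → Walk H k l zero A A
  step : ∀ {d A B C} → Vertex H k B → ∣ A ∩ B ∣ ≡ l →
         Walk H k l d B C → Walk H k l (suc d) A C

{-# OPTIONS --safe #-}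

-- Let s be the alternating string 1010… of length h. Among the points of H_s take A with k
-- points, where k 2^h ≤ n < k 2^(h+1), the rightmost ones if h = 0, and let B consist of the k
-- leftmost points of H₀.
-- Suppose consecutive islands I, J of a walk share two points p, q, and I lies in H_{s′} for a
-- prefix s′ of s of length j + 3 + c, where k - l < 2^c. Then J lies in H_t for the prefix t of
-- length j: otherwise, for some shorter prefix r whose next letter is b, J has a point g in
-- H_{r b̄} although p, q lie in H_{r b b̄ b}. The 2^c or more points of H_{r b b̄ b̄} between p and
-- q are on the same side of the line pq as g, and inside the triangle pqg because H_{rb} and
-- H_{r b̄} are separated; so they belong to J but not to I, which is too many. Hence each step
-- shortens the prefix by at most c + 3 = O(log (k - l)), while B is not contained in H_1.
module Submission where

open import Defs
import Data.Nat.Properties as ℕₚ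
open import Data.Bool using (Bool; true; false; not)
open import Data.Bool.Properties using (not-involutive)
open import Data.Fin as Fin using (Fin; toℕ; fromℕ<)
import Data.Fin.Properties as Finₚ
open import Data.Fin.Subset as Sub using (Subset; inside; outside; _∩_; _─_; ∣_∣)
import Data.Fin.Subset.Properties as Subₚ
open import Data.List using (List; []; _∷_; length; lookup)
open import Data.List.Membership.Propositional using (_∈_)
open import Data.List.Relation.Unary.Any using (here; there)
open import Data.Product using (Σ; ∃; _×_; _,_; proj₁; proj₂)
import Data.Rational as Rat
open Rat using (ℚ; 0ℚ; 1ℚ)
import Data.Rational.Properties as ℚₚ
open import Data.Rational.Solver using (module +-*-Solver)
open import Data.Sum using (_⊎_; inj₁; inj₂)
open import Data.Vec as Vec using ([]; _∷_; here; there)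
import Data.Vec.Properties as Vecₚ
open import Function using (_∘_)
open import Function.Definitions using (Injective)
open import Relation.Binary.Definitions using (tri<; tri≈; tri>)
open import Relation.Binary.PropositionalEquality
open import Relation.Nullary using (yes; no; does; contradiction)
open import Relation.Nullary.Decidable using (dec-true)
open import Relation.Unary using (Decidable)

-- Plane geometry

module _ where
  open Rat
  open +-*-Solver

  *-pos : ∀ {a b} → 0ℚ < a → 0ℚ < b → 0ℚ < a * b
  *-pos {a} {b} a>0 b>0 =
    ℚₚ.positive⁻¹ (a * b) {{ℚₚ.pos*pos⇒pos a {{positive a>0}} b {{positive b>0}}}}

  *-nonNeg : ∀ {a b} → 0ℚ ≤ a → 0ℚ ≤ b → 0ℚ ≤ a * b
  *-nonNeg {a} {b} a≥0 b≥0 =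
    ℚₚ.nonNegative⁻¹ (a * b) {{ℚₚ.nonNeg*nonNeg⇒nonNeg a {{nonNegative a≥0}} b {{nonNegative b≥0}}}}

  +-pos : ∀ {a b} → 0ℚ < a → 0ℚ < b → 0ℚ < a + b
  +-pos = ℚₚ.+-mono-<

  p<q⇒0<q-p : ∀ {p q} → p < q → 0ℚ < q - p
  p<q⇒0<q-p {p} {q} p<q = subst (_< q - p) (ℚₚ.+-inverseʳ p) (ℚₚ.+-monoˡ-< (- p) p<q)

  p≤q⇒0≤q-p : ∀ {p q} → p ≤ q → 0ℚ ≤ q - p
  p≤q⇒0≤q-p {p} {q} p≤q = subst (_≤ q - p) (ℚₚ.+-inverseʳ p) (ℚₚ.+-monoˡ-≤ (- p) p≤q)

  reciprocal : ∀ {a} → 0ℚ < a → Σ ℚ λ b → 0ℚ < b × b * a ≡ 1ℚ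
  reciprocal {a} a>0 =
    1/ a , ℚₚ.positive⁻¹ (1/ a) {{ℚₚ.1/pos⇒pos a}} , ℚₚ.*-inverseˡ a
    where
      instance
        a-pos : Positive a
        a-pos = positive a>0
        a-nonZero : NonZero a
        a-nonZero = ℚₚ.pos⇒nonZero a

  -- The weights need not sum to 1, so that determinants can serve as weights directly; dividing by
  -- `s + t` gives the parameter in `Convex`.
  convex₂ : ∀ {C p q z} → Convex C → ∀ {s t} → 0ℚ < s → 0ℚ < t →
    (s + t) * xc z ≡ s * xc p + t * xc q →
    (s + t) * yc z ≡ s * yc p + t * yc q → C p → C q → C z
  convex₂ {C} {p} {q} {z} conv {s} {t} s>0 t>0 eqx eqy Cp Cq
    with reciprocal (+-pos s>0 t>0)
  ... | w , w>0 , w*[s+t]≡1 =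
    subst C (cong₂ _,_ (coord (xc p) (xc q) (xc z) eqx) (coord (yc p) (yc q) (yc z) eqy))
      (conv p q (w * s) (ℚₚ.<⇒≤ (*-pos w>0 s>0)) ws≤1 Cp Cq)
    where
      ws+wt≡1 : w * s + w * t ≡ 1ℚ
      ws+wt≡1 = trans (sym (ℚₚ.*-distribˡ-+ w s t)) w*[s+t]≡1

      1-ws≡wt : 1ℚ - w * s ≡ w * t
      1-ws≡wt = trans (cong (_- w * s) (sym ws+wt≡1))
        (solve 2 (λ a b → a :+ b :- a := b) refl (w * s) (w * t))

      ws≤1 : w * s ≤ 1ℚ
      ws≤1 = subst₂ _≤_ (ℚₚ.+-identityʳ (w * s)) ws+wt≡1
        (ℚₚ.+-monoʳ-≤ (w * s) (ℚₚ.<⇒≤ (*-pos w>0 t>0)))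

      coord : ∀ a b c → (s + t) * c ≡ s * a + t * b → w * s * a + (1ℚ - w * s) * b ≡ c
      coord a b c eq = begin
        w * s * a + (1ℚ - w * s) * b ≡⟨ cong (λ u → w * s * a + u * b) 1-ws≡wt ⟩
        w * s * a + w * t * b        ≡⟨ solve 5 (λ w s t a b →
          w :* s :* a :+ w :* t :* b := w :* (s :* a :+ t :* b)) refl w s t a b ⟩
        w * (s * a + t * b)          ≡⟨ cong (w *_) eq ⟨
        w * ((s + t) * c)            ≡⟨ ℚₚ.*-assoc w (s + t) c ⟨
        w * (s + t) * c              ≡⟨ cong (_* c) w*[s+t]≡1 ⟩
        1ℚ * c                       ≡⟨ ℚₚ.*-identityˡ c ⟩
        c                            ∎
        where open ≡-Reasoning

  convex₃ : ∀ {C p q r z} → Convex C → ∀ {a b c} → 0ℚ < a → 0ℚ < b → 0ℚ < c →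
    (a + b + c) * xc z ≡ a * xc p + b * xc q + c * xc r →
    (a + b + c) * yc z ≡ a * yc p + b * yc q + c * yc r → C p → C q → C r → C z
  convex₃ {C} {p} {q} {r} {z} conv {a} {b} {c} a>0 b>0 c>0 eqx eqy Cp Cq Cr
    with reciprocal (+-pos a>0 b>0)
  ... | w , w>0 , w*[a+b]≡1 =
    convex₂ conv (+-pos a>0 b>0) c>0
      (trans eqx (cong (_+ c * xc r) (sym (mid (xc p) (xc q)))))
      (trans eqy (cong (_+ c * yc r) (sym (mid (yc p) (yc q)))))
      (convex₂ {z = m} conv a>0 b>0 (mid (xc p) (xc q)) (mid (yc p) (yc q)) Cp Cq) Cr
    where
      m : Point
      m = w * (a * xc p + b * xc q) , w * (a * yc p + b * yc q)

      mid : ∀ u v → (a + b) * (w * (a * u + b * v)) ≡ a * u + b * v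
      mid u v = trans
        (solve 3 (λ s w e → s :* (w :* e) := w :* s :* e) refl (a + b) w (a * u + b * v))
        (trans (cong (_* (a * u + b * v)) w*[a+b]≡1) (ℚₚ.*-identityˡ _))

signed : Bool → ℚ → ℚ
signed false a = a
signed true  a = Rat.- a

-- For `p` left of `q`, `false` puts `r` below the line and `true` above it. The index is thus the
-- half that contains `p` and `q` when `r` comes from the other half of a Horton set.
OnSide : Bool → Point → Point → Point → Set
OnSide b r p q = 0ℚ Rat.< signed b (lineMinus r p q)

module _ where
  open Rat
  open +-*-Solver

  lineMinusₚ : ∀ {n} (a b c d e f : Polynomial n) → Polynomial n
  lineMinusₚ rx ry px py qx qy = (py :- ry) :* (qx :- px) :+ (qy :- py) :* (rx :- px)

  -- Barycentric coordinates of z with respect to the triangle pqg.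
  barycentric-x : ∀ g p q z →
    (lineMinus g z q + lineMinus g p z + lineMinus z p q) * xc z ≡
    lineMinus g z q * xc p + lineMinus g p z * xc q + lineMinus z p q * xc g
  barycentric-x (gx , gy) (px , py) (qx , qy) (zx , zy) =
    solve 8 (λ gx gy px py qx qy zx zy →
      let α = lineMinusₚ gx gy zx zy qx qy
          β = lineMinusₚ gx gy px py zx zy
          γ = lineMinusₚ zx zy px py qx qy
      in (α :+ β :+ γ) :* zx := α :* px :+ β :* qx :+ γ :* gx) refl gx gy px py qx qy zx zy

  barycentric-y : ∀ g p q z →
    (lineMinus g z q + lineMinus g p z + lineMinus z p q) * yc z ≡
    lineMinus g z q * yc p + lineMinus g p z * yc q + lineMinus z p q * yc g
  barycentric-y (gx , gy) (px , py) (qx , qy) (zx , zy) =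
    solve 8 (λ gx gy px py qx qy zx zy →
      let α = lineMinusₚ gx gy zx zy qx qy
          β = lineMinusₚ gx gy px py zx zy
          γ = lineMinusₚ zx zy px py qx qy
      in (α :+ β :+ γ) :* zy := α :* py :+ β :* qy :+ γ :* gy) refl gx gy px py qx qy zx zy

  negate-combination : ∀ a b c z p q r → (a + b + c) * z ≡ a * p + b * q + c * r →
    (- a + - b + - c) * z ≡ - a * p + - b * q + - c * r
  negate-combination a b c z p q r eq = begin
    (- a + - b + - c) * z             ≡⟨ solve 4 (λ a b c z →
      (:- a :+ :- b :+ :- c) :* z := :- ((a :+ b :+ c) :* z)) refl a b c z ⟩
    - ((a + b + c) * z)               ≡⟨ cong -_ eq ⟩
    - (a * p + b * q + c * r)         ≡⟨ solve 6 (λ a b c p q r →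
      :- (a :* p :+ b :* q :+ c :* r) := :- a :* p :+ :- b :* q :+ :- c :* r) refl a b c p q r ⟩
    - a * p + - b * q + - c * r       ∎
    where open ≡-Reasoning

-- The three determinants are barycentric weights up to a common factor, so weights that are all
-- negative may change sign together.
triangle-convex : ∀ b {C p q g z} → Convex C →
  OnSide b g z q → OnSide b g p z → OnSide b z p q → C p → C q → C g → C z
triangle-convex false {p = p} {q} {g} {z} conv α>0 β>0 γ>0 =
  convex₃ conv α>0 β>0 γ>0 (barycentric-x g p q z) (barycentric-y g p q z)
triangle-convex true {p = p} {q} {g} {z} conv α>0 β>0 γ>0 =
  convex₃ conv α>0 β>0 γ>0
    (negate-combination α β γ (xc z) (xc p) (xc q) (xc g) (barycentric-x g p q z))
    (negate-combination α β γ (yc z) (yc p) (yc q) (yc g) (barycentric-y g p q z))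
  where
    α β γ : ℚ
    α = lineMinus g z q
    β = lineMinus g p z
    γ = lineMinus z p q

-- Islands from separating functionals

Affine : (Point → ℚ) → Set
Affine f = ∀ p q t → f ((t · p) ⊕ ((1ℚ Rat.- t) · q)) ≡ t Rat.* f p Rat.+ (1ℚ Rat.- t) Rat.* f q

Separated : (H : List Point) → Subset (length H) → Fin (length H) → Set
Separated H S i = Σ (Point → ℚ) λ f → Affine f ×
  (∀ j → j Sub.∈ S → 0ℚ Rat.< f (lookup H j)) × f (lookup H i) ≡ 0ℚ

-- The witness is the intersection of all open half-planes containing S; quantifying over
-- affine functionals rather than over convex sets keeps it in Set.
separated⇒island : ∀ H S → (∀ i → i Sub.∉ S → Separated H S i) → Island H S
separated⇒island H S sep = C , convex , λ i → (λ i∈S f _ S>0 → S>0 i i∈S) , C⇒S i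
  where
    open Rat

    C : Point → Set
    C z = ∀ f → Affine f → (∀ j → j Sub.∈ S → 0ℚ < f (lookup H j)) → 0ℚ < f z

    mix-pos : ∀ {t u v} → 0ℚ ≤ t → t ≤ 1ℚ → 0ℚ < u → 0ℚ < v → 0ℚ < t * u + (1ℚ - t) * v
    mix-pos {t} {u} {v} 0≤t t≤1 u>0 v>0 with 0ℚ ℚₚ.<? t
    ... | yes 0<t = ℚₚ.+-mono-<-≤ (*-pos 0<t u>0) (*-nonNeg (p≤q⇒0≤q-p t≤1) (ℚₚ.<⇒≤ v>0))
    ... | no  0≮t with ℚₚ.≤-antisym 0≤t (ℚₚ.≮⇒≥ 0≮t)
    ... | refl = subst (0ℚ <_) (sym eq) v>0
      where
        eq : 0ℚ * u + (1ℚ - 0ℚ) * v ≡ v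
        eq = trans (cong₂ _+_ (ℚₚ.*-zeroˡ u) (ℚₚ.*-identityˡ v)) (ℚₚ.+-identityˡ v)

    convex : Convex C
    convex p q t 0≤t t≤1 Cp Cq f aff S>0 =
      subst (0ℚ <_) (sym (aff p q t)) (mix-pos 0≤t t≤1 (Cp f aff S>0) (Cq f aff S>0))

    C⇒S : ∀ i → C (lookup H i) → i Sub.∈ S
    C⇒S i Ci with i Subₚ.∈? S
    ... | yes i∈S = i∈S
    ... | no  i∉S with sep i i∉S
    ... | f , aff , S>0 , fi≡0 = contradiction (subst (0ℚ <_) fi≡0 (Ci f aff S>0)) (ℚₚ.<-irrefl refl)

module _ where
  open Rat
  open +-*-Solver

  affine-x : ∀ a → Affine (λ z → xc z - a)
  affine-x a (px , _) (qx , _) t = solve 4 (λ a p q t →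
    t :* p :+ (con 1ℚ :- t) :* q :- a := t :* (p :- a) :+ (con 1ℚ :- t) :* (q :- a)) refl a px qx t

  affine-neg-x : ∀ a → Affine (λ z → a - xc z)
  affine-neg-x a (px , _) (qx , _) t = solve 4 (λ a p q t →
    a :- (t :* p :+ (con 1ℚ :- t) :* q) := t :* (a :- p) :+ (con 1ℚ :- t) :* (a :- q)) refl a px qx t

  affine-signed : ∀ b {f} → Affine f → Affine (λ z → signed b (f z))
  affine-signed false     aff       = aff
  affine-signed true  {f} aff p q t = trans (cong -_ (aff p q t))
    (solve 3 (λ t a b → :- (t :* a :+ (con 1ℚ :- t) :* b) := t :* (:- a) :+ (con 1ℚ :- t) :* (:- b))
      refl t (f p) (f q))

  -- lineMinus r p q is the cross product of q - r and p - r, so both summands are linear in z - r.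
  fan : Point → Point → Point → Point → ℚ
  fan r p q z = lineMinus r p z + lineMinus r z q

  affine-fan : ∀ r p q → Affine (fan r p q)
  affine-fan (rx , ry) (px , py) (qx , qy) (ux , uy) (vx , vy) t =
    solve 11 (λ rx ry px py qx qy ux uy vx vy t →
      let fanₚ = λ x y → lineMinusₚ rx ry px py x y :+ lineMinusₚ rx ry x y qx qy
      in fanₚ (t :* ux :+ (con 1ℚ :- t) :* vx) (t :* uy :+ (con 1ℚ :- t) :* vy)
         := t :* fanₚ ux uy :+ (con 1ℚ :- t) :* fanₚ vx vy) refl rx ry px py qx qy ux uy vx vy t

  signed-+ : ∀ b u v → signed b (u + v) ≡ signed b u + signed b v
  signed-+ false u v = refl
  signed-+ true  u v = ℚₚ.neg-distrib-+ u v

  fan-apex : ∀ b r p q → signed b (fan r p q r) ≡ 0ℚ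
  fan-apex b r@(rx , ry) p@(px , py) q@(qx , qy) = trans (cong (signed b) eq) (signed-0 b)
    where
      eq : fan r p q r ≡ 0ℚ
      eq = solve 6 (λ rx ry px py qx qy →
        lineMinusₚ rx ry px py rx ry :+ lineMinusₚ rx ry rx ry qx qy := con 0ℚ) refl rx ry px py qx qy
      signed-0 : ∀ b → signed b 0ℚ ≡ 0ℚ
      signed-0 false = refl
      signed-0 true  = refl

  lineMinus-degenerate : ∀ r p → lineMinus r p p ≡ 0ℚ
  lineMinus-degenerate (rx , ry) (px , py) =
    solve 4 (λ rx ry px py → lineMinusₚ rx ry px py px py := con 0ℚ) refl rx ry px py

  fan-left : ∀ b r p q → OnSide b r p q → 0ℚ < signed b (fan r p q p)
  fan-left b r p q = subst (λ a → 0ℚ < signed b a)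
    (sym (trans (cong (_+ lineMinus r p q) (lineMinus-degenerate r p)) (ℚₚ.+-identityˡ _)))

  fan-right : ∀ b r p q → OnSide b r p q → 0ℚ < signed b (fan r p q q)
  fan-right b r p q = subst (λ a → 0ℚ < signed b a)
    (sym (trans (cong (lineMinus r p q +_) (lineMinus-degenerate r q)) (ℚₚ.+-identityʳ _)))

  fan-between : ∀ b r p q z → OnSide b r p z → OnSide b r z q → 0ℚ < signed b (fan r p q z)
  fan-between b r p q z pz zq = subst (0ℚ <_) (sym (signed-+ b _ _)) (+-pos pz zq)

open import Data.Nat using (ℕ; zero; suc; _≤_; _<_; _+_; _*_; _^_; _∸_; _⊔_; z≤n; s≤s; z<s; s<s; s<s⁻¹; >-nonZero)

-- Finite subsets

rank : ∀ {n} (S : Subset n) {i} → i Sub.∈ S → Fin ∣ S ∣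
rank (inside  ∷ S) here        = Fin.zero
rank (inside  ∷ S) (there i∈S) = Fin.suc (rank S i∈S)
rank (outside ∷ S) (there i∈S) = rank S i∈S

rank-injective : ∀ {n} (S : Subset n) {i j} (i∈S : i Sub.∈ S) (j∈S : j Sub.∈ S) →
  rank S i∈S ≡ rank S j∈S → i ≡ j
rank-injective (inside  ∷ S) here        here        eq = refl
rank-injective (inside  ∷ S) (there i∈S) (there j∈S) eq =
  cong Fin.suc (rank-injective S i∈S j∈S (Finₚ.suc-injective eq))
rank-injective (outside ∷ S) (there i∈S) (there j∈S) eq =
  cong Fin.suc (rank-injective S i∈S j∈S eq)

enum : ∀ {n} (S : Subset n) → Fin ∣ S ∣ → Fin n
enum (inside  ∷ S) Fin.zero    = Fin.zero
enum (inside  ∷ S) (Fin.suc r) = Fin.suc (enum S r)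
enum (outside ∷ S) r           = Fin.suc (enum S r)

enum-∈ : ∀ {n} (S : Subset n) r → enum S r Sub.∈ S
enum-∈ (inside  ∷ S) Fin.zero    = here
enum-∈ (inside  ∷ S) (Fin.suc r) = there (enum-∈ S r)
enum-∈ (outside ∷ S) r           = there (enum-∈ S r)

enum-injective : ∀ {n} (S : Subset n) → Injective _≡_ _≡_ (enum S)
enum-injective (inside  ∷ S) {Fin.zero}  {Fin.zero}  eq = refl
enum-injective (inside  ∷ S) {Fin.suc r} {Fin.suc s} eq =
  cong Fin.suc (enum-injective S (Finₚ.suc-injective eq))
enum-injective (outside ∷ S) eq = enum-injective S (Finₚ.suc-injective eq)

injection⇒≤∣S∣ : ∀ {m n} (S : Subset n) (f : Fin m → Fin n) → Injective _≡_ _≡_ f →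
  (∀ r → f r Sub.∈ S) → m ≤ ∣ S ∣
injection⇒≤∣S∣ S f f-inj f∈S = Finₚ.injective⇒≤ {f = λ r → rank S (f∈S r)}
  (λ eq → f-inj (rank-injective S (f∈S _) (f∈S _) eq))

injection⇒∣S∣≤ : ∀ {k n} (S : Subset n) (f : ∀ {i} → i Sub.∈ S → Fin k) →
  (∀ {i j} (i∈S : i Sub.∈ S) (j∈S : j Sub.∈ S) → f i∈S ≡ f j∈S → i ≡ j) → ∣ S ∣ ≤ k
injection⇒∣S∣≤ S f f-inj = Finₚ.injective⇒≤ {f = λ r → f (enum-∈ S r)}
  (λ eq → enum-injective S (f-inj (enum-∈ S _) (enum-∈ S _) eq))

two-elements : ∀ {n} (S : Subset n) → 2 ≤ ∣ S ∣ →
  ∃ λ i → ∃ λ j → i Sub.∈ S × j Sub.∈ S × toℕ i < toℕ j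
two-elements S 2≤∣S∣ = order (ℕₚ.<-cmp (toℕ (enum S r₀)) (toℕ (enum S r₁)))
  where
    r₀ r₁ : Fin ∣ S ∣
    r₀ = fromℕ< (ℕₚ.<-trans z<s 2≤∣S∣)
    r₁ = fromℕ< 2≤∣S∣

    order : _ → _
    order (tri< a<b _ _) = enum S r₀ , enum S r₁ , enum-∈ S r₀ , enum-∈ S r₁ , a<b
    order (tri≈ _ a≡b _) = contradiction
      (Finₚ.fromℕ<-injective 0 1 _ _ (enum-injective S (Finₚ.toℕ-injective a≡b))) λ ()
    order (tri> _ _ b<a) = enum S r₁ , enum S r₀ , enum-∈ S r₁ , enum-∈ S r₀ , b<a

∣p∩q∣+∣q─p∣≡∣q∣ : ∀ {n} (p q : Subset n) → ∣ p ∩ q ∣ + ∣ q ─ p ∣ ≡ ∣ q ∣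
∣p∩q∣+∣q─p∣≡∣q∣ []            []            = refl
∣p∩q∣+∣q─p∣≡∣q∣ (inside  ∷ p) (inside  ∷ q) = cong suc (∣p∩q∣+∣q─p∣≡∣q∣ p q)
∣p∩q∣+∣q─p∣≡∣q∣ (inside  ∷ p) (outside ∷ q) = ∣p∩q∣+∣q─p∣≡∣q∣ p q
∣p∩q∣+∣q─p∣≡∣q∣ (outside ∷ p) (inside  ∷ q) =
  trans (ℕₚ.+-suc _ _) (cong suc (∣p∩q∣+∣q─p∣≡∣q∣ p q))
∣p∩q∣+∣q─p∣≡∣q∣ (outside ∷ p) (outside ∷ q) = ∣p∩q∣+∣q─p∣≡∣q∣ p q

module _ {n : ℕ} {P : Fin n → Set} (P? : Decidable P) where

  comprehension : Subset n
  comprehension = Vec.tabulate (λ i → does (P? i))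

  ∈-comprehension⁺ : ∀ {i} → P i → i Sub.∈ comprehension
  ∈-comprehension⁺ {i} Pi = Vecₚ.lookup⇒[]= i _
    (trans (Vecₚ.lookup∘tabulate _ i) (dec-true (P? i) Pi))

  ∈-comprehension⁻ : ∀ {i} → i Sub.∈ comprehension → P i
  ∈-comprehension⁻ {i} i∈S
    with P? i | trans (sym (Vecₚ.lookup∘tabulate (λ i → does (P? i)) i)) (Vecₚ.[]=⇒lookup i∈S)
  ... | yes Pi | _ = Pi

-- Parity classes of indices

double : ℕ → ℕ
double zero    = zero
double (suc m) = suc (suc (double m))

-- The position in a list of the m-th element of its half b, where false stands for evens
-- and true for odds.
branch : Bool → ℕ → ℕ
branch false m = double m
branch true  m = suc (double m)

double-mono-≤ : ∀ {i j} → i ≤ j → double i ≤ double j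
double-mono-≤ z≤n       = z≤n
double-mono-≤ (s≤s i≤j) = s≤s (s≤s (double-mono-≤ i≤j))

branch-mono-< : ∀ b {i j} → i < j → branch b i < branch b j
branch-mono-< false i<j = ℕₚ.<-≤-trans (ℕₚ.<-trans (ℕₚ.n<1+n _) (ℕₚ.n<1+n _)) (double-mono-≤ i<j)
branch-mono-< true  i<j = s<s (branch-mono-< false i<j)

-- The two halves interleave, which is what places points of the sibling class between two points of
-- a class.
suc-branch : ∀ b x → ∃ λ x′ → suc (branch b x) ≡ branch (not b) x′
suc-branch false x = x     , refl
suc-branch true  x = suc x , refl

branch-mono-≤ : ∀ b {i j} → i ≤ j → branch b i ≤ branch b j
branch-mono-≤ false i≤j = double-mono-≤ i≤j
branch-mono-≤ true  i≤j = s≤s (double-mono-≤ i≤j)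

suc-branch-< : ∀ b {i j} → i < j → suc (branch b i) < branch b j
suc-branch-< false i<j = double-mono-≤ i<j
suc-branch-< true  i<j = s≤s (double-mono-≤ i<j)

mono⇒injective : ∀ {f : ℕ → ℕ} → (∀ {i j} → i < j → f i < f j) → ∀ {i j} → f i ≡ f j → i ≡ j
mono⇒injective f-mono {i} {j} eq with ℕₚ.<-cmp i j
... | tri< i<j _ _ = contradiction eq (ℕₚ.<⇒≢ (f-mono i<j))
... | tri≈ _ i≡j _ = i≡j
... | tri> _ _ j<i = contradiction (sym eq) (ℕₚ.<⇒≢ (f-mono j<i))

mono⇒cancel-< : ∀ {f : ℕ → ℕ} → (∀ {i j} → i < j → f i < f j) → ∀ {i j} → f i < f j → i < j
mono⇒cancel-< f-mono {i} {j} lt with ℕₚ.<-cmp i j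
... | tri< i<j _ _ = i<j
... | tri≈ _ refl _ = contradiction lt (ℕₚ.<-irrefl refl)
... | tri> _ _ j<i = contradiction lt (ℕₚ.<-asym (f-mono j<i))

double≢1+double : ∀ i j → double i ≢ suc (double j)
double≢1+double (suc i) zero    ()
double≢1+double (suc i) (suc j) eq = double≢1+double i j (ℕₚ.suc-injective (ℕₚ.suc-injective eq))

branch-disjoint : ∀ b {i j} → branch b i ≢ branch (not b) j
branch-disjoint false {i} {j} eq = double≢1+double i j eq
branch-disjoint true  {i} {j} eq = double≢1+double j i (sym eq)

parity : ∀ m → ∃ λ b → ∃ λ i → m ≡ branch b i
parity zero    = false , zero , refl
parity (suc m) with parity m
... | false , i , refl = true  , i     , refl
... | true  , i , refl = false , suc i , refl

branch-cover : ∀ b m → (∃ λ i → m ≡ branch b i) ⊎ (∃ λ i → m ≡ branch (not b) i)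
branch-cover b m with b | parity m
... | false | false , i , eq = inj₁ (i , eq)
... | false | true  , i , eq = inj₂ (i , eq)
... | true  | false , i , eq = inj₂ (i , eq)
... | true  | true  , i , eq = inj₁ (i , eq)

double≡2* : ∀ m → double m ≡ 2 * m
double≡2* zero    = refl
double≡2* (suc m) = cong suc (trans (cong suc (double≡2* m)) (sym (ℕₚ.+-suc m _)))

double-+ : ∀ i w → double (i + w) ≡ double i + 2 * w
double-+ zero    w = double≡2* w
double-+ (suc i) w = cong (suc ∘ suc) (double-+ i w)

double-spread : ∀ i w j → i + w ≤ j → double i + 2 * w ≤ double j
double-spread i w j le = subst (_≤ double j) (double-+ i w) (double-mono-≤ le)

branch-spread : ∀ b i w j → i + w ≤ j → branch b i + 2 * w ≤ branch b j
branch-spread false i w j le = double-spread i w j le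
branch-spread true  i w j le = s≤s (double-spread i w j le)

-- Starting with `true` makes depth 1 the odd indices, so that index 0 lies outside. Alternation
-- makes `bit (2 + e)` agree with `bit e`.
bit : ℕ → Bool
bit zero    = true
bit (suc e) = not (bit e)

-- at e m is the index in H₀ of the m-th point of H_s, where s is the alternating string of
-- length e; bit e is the next letter of that string.
at : ℕ → ℕ → ℕ
at zero    m = m
at (suc e) m = at e (branch (bit e) m)

at-mono-< : ∀ e {i j} → i < j → at e i < at e j
at-mono-< zero    i<j = i<j
at-mono-< (suc e) i<j = at-mono-< e (branch-mono-< (bit e) i<j)

at-injective : ∀ e {i j} → at e i ≡ at e j → i ≡ j
at-injective e = mono⇒injective (at-mono-< e)

at-cancel-< : ∀ e {i j} → at e i < at e j → i < j
at-cancel-< e = mono⇒cancel-< (at-mono-< e)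

-- Each removed letter at least doubles a gap, as a half takes every second position. The witnesses
-- are the positions of the same two indices at depth `e`.
at-spread : ∀ c e {i j} w → i + w ≤ j →
  ∃ λ u → ∃ λ v → at (c + e) i ≡ at e u × at (c + e) j ≡ at e v × u + 2 ^ c * w ≤ v
at-spread zero    e {i} {j} w le =
  i , j , refl , refl , subst (λ a → i + a ≤ j) (sym (ℕₚ.*-identityˡ w)) le
at-spread (suc c) e {i} {j} w le
  with at-spread c e (2 * w) (branch-spread (bit (c + e)) i w j le)
... | u , v , i≡ , j≡ , u≤v = u , v , i≡ , j≡ , subst (λ a → u + a ≤ v) eq u≤v
  where
    eq : 2 ^ c * (2 * w) ≡ 2 ^ suc c * w
    eq = trans (sym (ℕₚ.*-assoc (2 ^ c) 2 w)) (cong (_* w) (ℕₚ.*-comm (2 ^ c) 2))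

-- A class of depth `e` has exactly one index in each block of `2 ^ e` consecutive ones.
at-bound : ∀ e m → at e m < 2 ^ e * suc m
at-bound zero    m = subst (m <_) (sym (ℕₚ.*-identityˡ (suc m))) (ℕₚ.n<1+n m)
at-bound (suc e) m = begin-strict
  at e (branch (bit e) m)           <⟨ at-bound e _ ⟩
  2 ^ e * suc (branch (bit e) m)    ≤⟨ ℕₚ.*-monoʳ-≤ (2 ^ e) (bound (bit e)) ⟩
  2 ^ e * (2 * suc m)               ≡⟨ ℕₚ.*-assoc (2 ^ e) 2 (suc m) ⟨
  2 ^ e * 2 * suc m                 ≡⟨ cong (_* suc m) (ℕₚ.*-comm (2 ^ e) 2) ⟩
  2 ^ suc e * suc m                 ∎
  where
    open ℕₚ.≤-Reasoning
    double≤2* : double (suc m) ≤ 2 * suc m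
    double≤2* = ℕₚ.≤-reflexive (double≡2* (suc m))
    bound : ∀ b → suc (branch b m) ≤ 2 * suc m
    bound false = ℕₚ.<-trans (ℕₚ.n<1+n _) double≤2*
    bound true  = double≤2*

InClass : ℕ → ℕ → Set
InClass e i = ∃ λ m → i ≡ at e m

InClass-mono : ∀ {d e i} → d ≤ e → InClass e i → InClass d i
InClass-mono {d} {e} d≤e (m , i≡) with ℕₚ.m≤n⇒m<n∨m≡n d≤e
... | inj₂ refl = m , i≡
InClass-mono {d} {suc e} d≤e (m , i≡) | inj₁ (s≤s d≤e′) =
  InClass-mono d≤e′ (branch (bit e) m , i≡)

-- Halves of point lists

-- Total lookup: positions past the end give the junk point (0, 0).
nth : List Point → ℕ → Point
nth []       _       = 0ℚ , 0ℚ
nth (p ∷ ps) zero    = p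
nth (p ∷ ps) (suc i) = nth ps i

lookup≡nth : ∀ H i → lookup H i ≡ nth H (toℕ i)
lookup≡nth (p ∷ ps) Fin.zero    = refl
lookup≡nth (p ∷ ps) (Fin.suc i) = lookup≡nth ps i

nth-∈ : ∀ H {i} → i < length H → nth H i ∈ H
nth-∈ (p ∷ ps) {zero}  _         = here refl
nth-∈ (p ∷ ps) {suc i} (s≤s i<n) = there (nth-∈ ps i<n)

nth-increasing : ∀ H → StrictlyIncX H → ∀ {i j} → i < j → j < length H →
  xc (nth H i) Rat.< xc (nth H j)
nth-increasing H inc {i} {j} i<j j<n = subst₂ (λ p q → xc p Rat.< xc q)
  (trans (lookup≡nth H _) (cong (nth H) (Finₚ.toℕ-fromℕ< i<n)))
  (trans (lookup≡nth H _) (cong (nth H) (Finₚ.toℕ-fromℕ< j<n)))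
  (inc (fromℕ< i<n) (fromℕ< j<n)
    (subst₂ _<_ (sym (Finₚ.toℕ-fromℕ< i<n)) (sym (Finₚ.toℕ-fromℕ< j<n)) i<j))
  where
    i<n : i < length H
    i<n = ℕₚ.<-trans i<j j<n

half : Bool → List Point → List Point
half false = evens
half true  = odds

nth-evens : ∀ H m → nth (evens H) m ≡ nth H (double m)
nth-odds  : ∀ H m → nth (odds H) m ≡ nth H (suc (double m))
nth-evens []       m       = refl
nth-evens (p ∷ ps) zero    = refl
nth-evens (p ∷ ps) (suc m) = nth-odds ps m
nth-odds  []       m       = refl
nth-odds  (p ∷ ps) m       = nth-evens ps m

nth-half : ∀ b H m → nth (half b H) m ≡ nth H (branch b m)
nth-half false = nth-evens
nth-half true  = nth-odds

length-evens : ∀ H m → double m < length H → m < length (evens H)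
length-odds  : ∀ H m → suc (double m) < length H → m < length (odds H)
length-evens (p ∷ ps) zero    _  = z<s
length-evens (p ∷ ps) (suc m) lt = s<s (length-odds ps m (s<s⁻¹ lt))
length-odds  (p ∷ ps) m       lt = length-evens ps m (s<s⁻¹ lt)

length-half : ∀ b H m → branch b m < length H → m < length (half b H)
length-half false = length-evens
length-half true  = length-odds

small-half : ∀ b H → length H ≤ 1 → length (half b H) ≤ 1
small-half false []       _ = z≤n
small-half false (p ∷ []) _ = s≤s z≤n
small-half true  []       _ = z≤n
small-half true  (p ∷ []) _ = z≤n
small-half _ (_ ∷ _ ∷ _) (s≤s ())

Horton-half : ∀ b {H} → Horton H → Horton (half b H)
Horton-half b {H} (small ≤1) = small (small-half b H ≤1)
Horton-half false (split e o _) = e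
Horton-half true  (split e o _) = o

-- The two values of `b` select the two inequalities of `HighAbove`, the second negated by `signed`.
Horton-onSide : ∀ {H} → Horton H → ∀ b {u v g} →
  branch b u < length H → branch b v < length H → branch (not b) g < length H →
  xc (nth H (branch b u)) Rat.< xc (nth H (branch b v)) →
  OnSide b (nth H (branch (not b) g)) (nth H (branch b u)) (nth H (branch b v))
-- A list of length at most 1 has no odd position; `g` supplies one here, `u` in the next case.
Horton-onSide (small ≤1) false _ _ g< _ = contradiction (ℕₚ.<-≤-trans g< ≤1) λ { (s≤s ()) }
Horton-onSide (small ≤1) true  u< _ _ _ = contradiction (ℕₚ.<-≤-trans u< ≤1) λ { (s≤s ()) }
Horton-onSide {H} (split _ _ (_ , above , _)) false {u} {v} {g} u< v< g< x< = above _ _ _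
  (subst (_∈ evens H) (nth-evens H u) (nth-∈ _ (length-evens H u u<)))
  (subst (_∈ evens H) (nth-evens H v) (nth-∈ _ (length-evens H v v<)))
  (subst (_∈ odds  H) (nth-odds  H g) (nth-∈ _ (length-odds  H g g<))) x<
Horton-onSide {H} (split _ _ (_ , _ , below)) true {u} {v} {g} u< v< g< x< = ℚₚ.neg-antimono-< (below _ _ _
  (subst (_∈ odds  H) (nth-odds  H u) (nth-∈ _ (length-odds  H u u<)))
  (subst (_∈ odds  H) (nth-odds  H v) (nth-∈ _ (length-odds  H v v<)))
  (subst (_∈ evens H) (nth-evens H g) (nth-∈ _ (length-evens H g g<))) x<)

level : List Point → ℕ → List Point
level H zero    = H
level H (suc e) = half (bit e) (level H e)

nth-level : ∀ H e m → nth (level H e) m ≡ nth H (at e m)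
nth-level H zero    m = refl
nth-level H (suc e) m = trans (nth-half (bit e) (level H e) m) (nth-level H e _)

length-level : ∀ H e m → at e m < length H → m < length (level H e)
length-level H zero    m lt = lt
length-level H (suc e) m lt = length-half (bit e) (level H e) m (length-level H e _ lt)

Horton-level : ∀ {H} → Horton H → ∀ e → Horton (level H e)
Horton-level hor zero    = hor
Horton-level hor (suc e) = Horton-half (bit e) (Horton-level hor e)

module _ {H : List Point} (inc : StrictlyIncX H) (hor : Horton H) where

  -- Every `level H e` is again Horton, and the order of positions gives the order of x-coordinates.
  -- Here `u` and `v` count at depth `suc e`, `g` in its sibling half.
  level-onSide : ∀ e {u v g} → u < v → at (suc e) v < length H →
    at e (branch (not (bit e)) g) < length H →
    OnSide (bit e) (nth H (at e (branch (not (bit e)) g))) (nth H (at (suc e) u)) (nth H (at (suc e) v))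
  level-onSide e {u} {v} {g} u<v v< g< =
    subst (λ r → OnSide b r (nth H (at (suc e) u)) (nth H (at (suc e) v))) (nth-level H e _)
    (subst₂ (OnSide b (nth L (branch (not b) g))) (nth-level H e _) (nth-level H e _)
    (Horton-onSide (Horton-level hor e) b
      (length-level H e _ (ℕₚ.<-trans (at-mono-< (suc e) u<v) v<)) (length-level H e _ v<) (length-level H e _ g<)
      (subst₂ (λ p q → xc p Rat.< xc q) (sym (nth-level H e _)) (sym (nth-level H e _))
        (nth-increasing H inc (at-mono-< (suc e) u<v) v<))))
    where
      b = bit e
      L = level H e

-- Windows of a class

-- An index outside the class departs from the alternating string at a first letter `e`; the Horton
-- property at that letter then applies to it.
locate : ∀ h i → InClass h i ⊎ (∃ λ e → e < h × ∃ λ g → i ≡ at e (branch (not (bit e)) g))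
locate zero    i = inj₁ (i , refl)
locate (suc h) i with locate h i
... | inj₂ (e , e<h , g , i≡) = inj₂ (e , ℕₚ.m<n⇒m<1+n e<h , g , i≡)
... | inj₁ (m , i≡) with branch-cover (bit h) m
... | inj₁ (m′ , refl) = inj₁ (m′ , i≡)
... | inj₂ (g  , refl) = inj₂ (h , ℕₚ.n<1+n h , g , i≡)

-- One construction gives all the vertices in use: start 0 at depth `h` for the deep one, and starts
-- 0 and `n ∸ K` at depth 0 for the leftmost and rightmost ones.
window : (n h M k : ℕ) → Subset n
window n h M k = comprehension {n} (λ i → ℕₚ.anyUpTo? (λ m → toℕ i ℕₚ.≟ at h (M + m)) k)

module _ {n : ℕ} (h M k : ℕ) where

  ∈-window⁺ : ∀ {i : Fin n} {m} → m < k → toℕ i ≡ at h (M + m) → i Sub.∈ window n h M k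
  ∈-window⁺ m<k i≡ = ∈-comprehension⁺
    (λ i → ℕₚ.anyUpTo? (λ m → toℕ i ℕₚ.≟ at h (M + m)) k) (_ , m<k , i≡)

  ∈-window⁻ : ∀ {i : Fin n} → i Sub.∈ window n h M k → ∃ λ m → m < k × toℕ i ≡ at h (M + m)
  ∈-window⁻ = ∈-comprehension⁻ (λ i → ℕₚ.anyUpTo? (λ m → toℕ i ℕₚ.≟ at h (M + m)) k)

  ∣window∣ : (∀ {m} → m < k → at h (M + m) < n) → ∣ window n h M k ∣ ≡ k
  ∣window∣ fits = ℕₚ.≤-antisym
    (injection⇒∣S∣≤ W (λ i∈W → fromℕ< (proj₁ (proj₂ (∈-window⁻ i∈W)))) offset-injective)
    (injection⇒≤∣S∣ W (λ r → fromℕ< (fits (Finₚ.toℕ<n r))) point-injective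
      (λ r → ∈-window⁺ (Finₚ.toℕ<n r) (Finₚ.toℕ-fromℕ< _)))
    where
      W = window n h M k

      offset-injective : ∀ {i j} (i∈W : i Sub.∈ W) (j∈W : j Sub.∈ W) →
        fromℕ< (proj₁ (proj₂ (∈-window⁻ i∈W))) ≡ fromℕ< (proj₁ (proj₂ (∈-window⁻ j∈W))) → i ≡ j
      offset-injective i∈W j∈W eq with ∈-window⁻ i∈W | ∈-window⁻ j∈W
      ... | m , m<k , i≡ | m′ , m′<k , j≡ with Finₚ.fromℕ<-injective m m′ m<k m′<k eq
      ... | refl = Finₚ.toℕ-injective (trans i≡ (sym j≡))

      point-injective : Injective _≡_ _≡_ (λ (r : Fin k) → fromℕ< (fits (Finₚ.toℕ<n r)))
      point-injective {r} {s} eq = Finₚ.toℕ-injective (ℕₚ.+-cancelˡ-≡ M _ _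
        (at-injective h (Finₚ.fromℕ<-injective _ _ _ _ eq)))

module _ {H : List Point} (inc : StrictlyIncX H) (hor : Horton H) where

  private
    n = length H

    lookup-fromℕ< : ∀ {i} (i<n : i < n) → lookup H (fromℕ< i<n) ≡ nth H i
    lookup-fromℕ< i<n = trans (lookup≡nth H _) (cong (nth H) (Finₚ.toℕ-fromℕ< i<n))

  class-onSide : ∀ {h e g x y} → e < h → x < y → at h y < n → at e (branch (not (bit e)) g) < n →
    OnSide (bit e) (nth H (at e (branch (not (bit e)) g))) (nth H (at h x)) (nth H (at h y))
  class-onSide {h} {e} {g} {x} {y} e<h x<y y< g<
    with InClass-mono e<h (x , refl) | InClass-mono e<h (y , refl)
  ... | u , x≡ | v , y≡ = subst₂ (OnSide (bit e) (nth H (at e (branch (not (bit e)) g))))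
    (cong (nth H) (sym x≡)) (cong (nth H) (sym y≡))
    (level-onSide inc hor e (at-cancel-< (suc e) (subst₂ _<_ x≡ y≡ (at-mono-< h x<y)))
      (subst (_< n) y≡ y<) g<)

  module _ (h M k : ℕ) (fits : ∀ {m} → m < suc (suc k) → at h (M + m) < n) where

    private
      W = window n h M (suc (suc k))

      point : ℕ → Point
      point m = nth H (at h (M + m))

      on-window : ∀ (f : Point → ℚ) → (∀ m → m < suc (suc k) → 0ℚ Rat.< f (point m)) →
        ∀ j → j Sub.∈ W → 0ℚ Rat.< f (lookup H j)
      on-window f f>0 j j∈W with ∈-window⁻ h M (suc (suc k)) j∈W
      ... | m , m<k , j≡ = subst (λ p → 0ℚ Rat.< f p)
        (sym (trans (lookup≡nth H j) (cong (nth H) j≡))) (f>0 m m<k)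

      -- The zero set of this `fan` is the line through `r` parallel to the chord joining the ends
      -- of the window. At an inner point both determinants are positive; at an end one of them
      -- vanishes.
      fan-pos : ∀ b r → (∀ {x y} → x < y → y < suc (suc k) → OnSide b r (point x) (point y)) →
        ∀ m → m < suc (suc k) → 0ℚ Rat.< signed b (fan r (point 0) (point (suc k)) (point m))
      fan-pos b r side zero    _ = fan-left b r (point 0) (point (suc k)) (side z<s (ℕₚ.n<1+n _))
      fan-pos b r side (suc m) (s<s m<) with ℕₚ.m<1+n⇒m<n∨m≡n m<
      ... | inj₁ m<k  = fan-between b r (point 0) (point (suc k)) (point (suc m))
        (side z<s (s<s m<)) (side (s<s m<k) (ℕₚ.n<1+n _))
      ... | inj₂ refl = fan-right b r (point 0) (point (suc k)) (side z<s (ℕₚ.n<1+n _))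

      -- A point departing at letter `e` sees all chords of the window from one side and is cut off
      -- by the parallel to the longest one. A point of the same class lies left or right of the
      -- window and is cut off by a vertical line.
      separated : ∀ i → i Sub.∉ W → Separated H W i
      separated i i∉W with locate h (toℕ i)
      ... | inj₂ (e , e<h , g , i≡) =
          f
        , affine-signed (bit e) (affine-fan r (point 0) (point (suc k)))
        , on-window f (fan-pos (bit e) r λ x<y y<k →
            class-onSide e<h (ℕₚ.+-monoʳ-< M x<y) (fits y<k) (subst (_< n) i≡ (Finₚ.toℕ<n i)))
        , trans (cong f (trans (lookup≡nth H i) (cong (nth H) i≡)))
            (fan-apex (bit e) r (point 0) (point (suc k)))
        where
          r : Point
          r = nth H (at e (branch (not (bit e)) g))
          f : Point → ℚ
          f z = signed (bit e) (fan r (point 0) (point (suc k)) z)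
      ... | inj₁ (m , i≡) with m ℕₚ.<? M | m ℕₚ.<? M + suc (suc k)
      ... | yes m<M | _ =
          f
        , affine-x (xc (lookup H i))
        , on-window f (λ m′ m′<k → p<q⇒0<q-p (subst (λ p → xc p Rat.< _) (sym i-point)
            (nth-increasing H inc (at-mono-< h (ℕₚ.<-≤-trans m<M (ℕₚ.m≤m+n M m′))) (fits m′<k))))
        , ℚₚ.+-inverseʳ (xc (lookup H i))
        where
          f : Point → ℚ
          f z = xc z Rat.- xc (lookup H i)
          i-point : lookup H i ≡ nth H (at h m)
          i-point = trans (lookup≡nth H i) (cong (nth H) i≡)
      ... | no m≮M | no m≮ =
          f
        , affine-neg-x (xc (lookup H i))
        , on-window f (λ m′ m′<k → p<q⇒0<q-p (subst (λ p → _ Rat.< xc p) (sym i-point)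
            (nth-increasing H inc
              (at-mono-< h (ℕₚ.<-≤-trans (ℕₚ.+-monoʳ-< M m′<k) (ℕₚ.≮⇒≥ m≮)))
              (subst (_< n) i≡ (Finₚ.toℕ<n i)))))
        , ℚₚ.+-inverseʳ (xc (lookup H i))
        where
          f : Point → ℚ
          f z = xc (lookup H i) Rat.- xc z
          i-point : lookup H i ≡ nth H (at h m)
          i-point = trans (lookup≡nth H i) (cong (nth H) i≡)
      -- The remaining positions are those of the window itself.
      ... | no m≮M | yes m< = contradiction (∈-window⁺ h M (suc (suc k)) offset< i≡′) i∉W
        where
          m≡ : M + (m ∸ M) ≡ m
          m≡ = ℕₚ.m+[n∸m]≡n (ℕₚ.≮⇒≥ m≮M)
          offset< : m ∸ M < suc (suc k)
          offset< = ℕₚ.+-cancelˡ-< M _ _ (subst (_< M + suc (suc k)) (sym m≡) m<)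
          i≡′ : toℕ i ≡ at h (M + (m ∸ M))
          i≡′ = trans i≡ (cong (at h) (sym m≡))

    window-vertex : Vertex H (suc (suc k)) W
    window-vertex = separated⇒island H W separated , ∣window∣ h M (suc (suc k)) fits

  -- How fast a walk can leave a class

  module _ {I J : Subset (length H)} {c : ℕ} (J-island : Island H J) (2≤∣I∩J∣ : 2 ≤ ∣ I ∩ J ∣)
    (∣J─I∣<2^c : ∣ J ─ I ∣ < 2 ^ c) where

    private
      C = proj₁ J-island
      C-convex = proj₁ (proj₂ J-island)

      J⇒C : ∀ {i x} → i Sub.∈ J → toℕ i ≡ x → C (nth H x)
      J⇒C {i} i∈J i≡ = subst C (trans (lookup≡nth H i) (cong (nth H) i≡))
        (proj₁ (proj₂ (proj₂ J-island) i) i∈J)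

      C⇒J : ∀ {x} (x<n : x < n) → C (nth H x) → fromℕ< x<n Sub.∈ J
      C⇒J x<n Cx = proj₂ (proj₂ (proj₂ J-island) _) (subst C (sym (lookup-fromℕ< x<n)) Cx)

    -- If J left H_s through g, then in the triangle spanned by g and two common points p, q
    -- it would swallow all points of H_{s b b̄ b̄} between p and q, none of which is in I.
    no-escape : ∀ e {u v g} → u + 2 ^ c ≤ v →
      (∀ {i} → i Sub.∈ I → InClass (3 + e) (toℕ i)) →
      at (3 + e) v < n → at e (branch (not (bit e)) g) < n →
      C (nth H (at (3 + e) u)) → C (nth H (at (3 + e) v)) →
      C (nth H (at e (branch (not (bit e)) g))) → 2 ^ c ≤ ∣ J ─ I ∣
    no-escape e {u} {v} {g} u+2^c≤v I⊆ v<n g<n Cu Cv Cg =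
      injection⇒≤∣S∣ (J ─ I) swallowed swallowed-injective
        (λ y → Subₚ.x∈p∧x∉q⇒x∈p─q (C⇒J (pos<n y) (in-C y)) (∉I y))
      where
        b = bit (2 + e)

        -- One place after a point of depth `3 + e`, counted at depth `2 + e`: a position of the
        -- sibling half, strictly between the two common points.
        pos : Fin (2 ^ c) → ℕ
        pos y = suc (branch b (u + toℕ y))

        pos< : ∀ y → pos y < branch b v
        pos< y = suc-branch-< b (ℕₚ.<-≤-trans (ℕₚ.+-monoʳ-< u (Finₚ.toℕ<n y)) u+2^c≤v)

        <pos : ∀ y → branch b u < pos y
        <pos y = s≤s (branch-mono-≤ b (ℕₚ.m≤m+n u _))

        pos<n : ∀ y → at (2 + e) (pos y) < n
        pos<n y = ℕₚ.<-trans (at-mono-< (2 + e) (pos< y)) v<n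

        swallowed : Fin (2 ^ c) → Fin n
        swallowed y = fromℕ< (pos<n y)

        swallowed-injective : Injective _≡_ _≡_ swallowed
        swallowed-injective {y} {y′} eq = Finₚ.toℕ-injective (ℕₚ.+-cancelˡ-≡ u _ _
          (mono⇒injective (branch-mono-< b) (ℕₚ.suc-injective
            (at-injective (2 + e) (Finₚ.fromℕ<-injective _ _ (pos<n y) (pos<n y′) eq)))))

        in-C : ∀ y → C (nth H (at (2 + e) (pos y)))
        -- The separation at letter `e` gives the signs of the weights of the two common points;
        -- `z-side` gives that of the weight of the escaping point.
        in-C y = triangle-convex (bit e) C-convex
          (level-onSide inc hor e (branch-mono-< (bit (suc e)) (pos< y)) v<n g<n)
          (level-onSide inc hor e (branch-mono-< (bit (suc e)) (<pos y)) (pos<n y) g<n)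
          z-side Cu Cv Cg
          where
            z-side : OnSide (bit e) (nth H (at (2 + e) (pos y)))
              (nth H (at (3 + e) u)) (nth H (at (3 + e) v))
            z-side with suc-branch b (u + toℕ y)
            ... | x , pos≡ = subst₂
              (λ b′ z → OnSide b′ (nth H (at (2 + e) z)) (nth H (at (3 + e) u)) (nth H (at (3 + e) v)))
              -- Two letters apart the string repeats, so the separation at letter `2 + e` puts the
              -- swallowed point on the same side as the escaping one.
              (not-involutive (bit e)) (sym pos≡)
              (level-onSide inc hor (2 + e)
                (ℕₚ.<-≤-trans (ℕₚ.m<m+n u (ℕₚ.m^n>0 2 c)) u+2^c≤v) v<n
                (subst (λ z → at (2 + e) z < n) pos≡ (pos<n y)))

        ∉I : ∀ y → swallowed y Sub.∉ I
        ∉I y y∈I with I⊆ y∈I | suc-branch b (u + toℕ y)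
        ... | m , y≡ | x , pos≡ = branch-disjoint b {m} {x} (trans (sym (at-injective (2 + e)
          (trans (sym (Finₚ.toℕ-fromℕ< (pos<n y))) y≡))) pos≡)

    -- A point of `J` with the wrong next letter would be the `g` of `no-escape`. Of the surplus
    -- depth of `I`, three letters provide the alternating pattern and `c` letters force the two
    -- common points `2 ^ c` positions apart.
    deepen : ∀ e → (∀ {i} → i Sub.∈ I → InClass (c + (3 + e)) (toℕ i)) →
      (∀ {i} → i Sub.∈ J → InClass e (toℕ i)) → ∀ {i} → i Sub.∈ J → InClass (suc e) (toℕ i)
    deepen e I⊆ J⊆ {i} i∈J with J⊆ i∈J
    ... | m , i≡ with branch-cover (bit e) m
    ... | inj₁ (m′ , refl) = m′ , i≡
    ... | inj₂ (g  , refl) with two-elements (I ∩ J) 2≤∣I∩J∣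
    ... | p , q , p∈ , q∈ , p<q
      with Subₚ.x∈p∩q⁻ I J p∈ | Subₚ.x∈p∩q⁻ I J q∈
    ... | p∈I , p∈J | q∈I , q∈J with I⊆ p∈I | I⊆ q∈I
    ... | x , p≡ | y , q≡
      with at-spread c (3 + e) 1
             (subst (_≤ y) (ℕₚ.+-comm 1 x) (at-cancel-< (c + (3 + e)) (subst₂ _<_ p≡ q≡ p<q)))
    ... | u , v , x≡ , y≡ , u≤v = contradiction
      (no-escape e (subst (λ a → u + a ≤ v) (ℕₚ.*-identityʳ (2 ^ c)) u≤v)
        (λ i∈I → InClass-mono (ℕₚ.m≤n+m (3 + e) c) (I⊆ i∈I))
        (subst (_< n) (trans q≡ y≡) (Finₚ.toℕ<n q)) (subst (_< n) i≡ (Finₚ.toℕ<n i))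
        (J⇒C p∈J (trans p≡ x≡)) (J⇒C q∈J (trans q≡ y≡)) (J⇒C i∈J i≡))
      (ℕₚ.<⇒≱ ∣J─I∣<2^c)

    -- Depth 0 is no restriction; `deepen` then adds one letter at a time, and the depth of `I`
    -- suffices for every round below `j`.
    step-class : ∀ j → (∀ {i} → i Sub.∈ I → InClass (c + (3 + j)) (toℕ i)) →
      ∀ {i} → i Sub.∈ J → InClass j (toℕ i)
    step-class j I⊆ = go j ℕₚ.≤-refl
      where
        go : ∀ e → e ≤ j → ∀ {i} → i Sub.∈ J → InClass e (toℕ i)
        go zero    _   {i} _ = toℕ i , refl
        go (suc e) e<j       = deepen e
          (λ i∈I → InClass-mono (ℕₚ.+-monoʳ-≤ c (ℕₚ.+-monoʳ-≤ 3 (ℕₚ.<⇒≤ e<j))) (I⊆ i∈I))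
          (go e (ℕₚ.<⇒≤ e<j))

  -- Each edge spends `c + 3` letters: its new vertex has exactly `k ∸ l` points outside the
  -- previous one, fewer than `2 ^ c`.
  walk-class : ∀ {k l c} → 2 ≤ l → k ∸ l < 2 ^ c → ∀ {d A B} j → Walk H k l d A B →
    (∀ {i} → i Sub.∈ A → InClass (d * (c + 3) + j) (toℕ i)) → ∀ {i} → i Sub.∈ B → InClass j (toℕ i)
  walk-class 2≤l w< j here A⊆ = A⊆
  walk-class {k} {l} {c} 2≤l w< {suc d} {A} j (step {B = B} (B-island , ∣B∣≡k) ∣A∩B∣≡l walk) A⊆ =
    walk-class 2≤l w< j walk
      (step-class {I = A} {B} {c} B-island (subst (2 ≤_) (sym ∣A∩B∣≡l) 2≤l)
        (subst (_< 2 ^ c) (sym ∣B─A∣≡) w<) _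
        (λ {i} i∈A → subst (λ a → InClass a (toℕ i)) regroup (A⊆ i∈A)))
    where
      regroup : suc d * (c + 3) + j ≡ c + (3 + (d * (c + 3) + j))
      regroup = trans (ℕₚ.+-assoc (c + 3) (d * (c + 3)) j) (ℕₚ.+-assoc c 3 _)

      ∣B─A∣≡ : ∣ B ─ A ∣ ≡ k ∸ l
      ∣B─A∣≡ = begin
        ∣ B ─ A ∣                          ≡⟨ ℕₚ.m+n∸m≡n ∣ A ∩ B ∣ _ ⟨
        ∣ A ∩ B ∣ + ∣ B ─ A ∣ ∸ ∣ A ∩ B ∣  ≡⟨ cong₂ _∸_ (trans (∣p∩q∣+∣q─p∣≡∣q∣ A B) ∣B∣≡k) ∣A∩B∣≡l ⟩
        k ∸ l                              ∎
        where open ≡-Reasoning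

-- Dyadic scales

-- `h` is the integer part of the binary logarithm of n / k. Fuel `n` suffices since `n < 2 ^ n`.
bracket : ∀ k n → 1 ≤ k → k ≤ n → ∃ λ h → k * 2 ^ h ≤ n × n < k * 2 ^ suc h
bracket k n 1≤k k≤n = search n 0 (subst (_≤ n) (sym (ℕₚ.*-identityʳ k)) k≤n)
  (subst (λ a → n < k * 2 ^ a) (sym (ℕₚ.+-identityʳ n))
    (ℕₚ.<-≤-trans (n<2^n n) (ℕₚ.m≤n*m (2 ^ n) k {{>-nonZero 1≤k}})))
  where
    n<2^n : ∀ n → n < 2 ^ n
    n<2^n zero    = z<s
    n<2^n (suc n) = begin-strict
      suc n             <⟨ s<s (n<2^n n) ⟩
      1 + 2 ^ n         ≤⟨ ℕₚ.+-monoˡ-≤ (2 ^ n) (ℕₚ.m^n>0 2 n) ⟩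
      2 ^ n + 2 ^ n     ≡⟨ cong (2 ^ n +_) (ℕₚ.+-identityʳ _) ⟨
      2 ^ suc n         ∎
      where open ℕₚ.≤-Reasoning

    search : ∀ fuel h → k * 2 ^ h ≤ n → n < k * 2 ^ (fuel + h) →
      ∃ λ h → k * 2 ^ h ≤ n × n < k * 2 ^ suc h
    search zero       h lo hi = contradiction lo (ℕₚ.<⇒≱ hi)
    search (suc fuel) h lo hi with n ℕₚ.<? k * 2 ^ suc h
    ... | yes n< = h , lo , n<
    ... | no  n≮ = search fuel (suc h) (ℕₚ.≮⇒≥ n≮)
      (subst (λ a → n < k * 2 ^ a) (sym (ℕₚ.+-suc fuel h)) hi)

-- Each edge accounts for `c + 4` letters, and as there is at least one edge, a fifth extra letter
-- per edge absorbs the rounding of `h`. The exponent 6 is these five factors 2 together with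
-- `2 ^ c ≤ w`; the maximum with 2 lets the base absorb them even for `w = 1`.
distance-bound : ∀ {k n h c w} d → 2 ^ c ≤ w → n < k * 2 ^ suc h → h ≤ suc d * (suc c + 3) →
  n ≤ k * (2 ⊔ w) ^ (6 * suc d)
distance-bound {k} {n} {h} {c} {w} d 2^c≤w n< h≤ = begin
  n                                        ≤⟨ ℕₚ.<⇒≤ n< ⟩
  k * 2 ^ suc h                            ≤⟨ ℕₚ.*-monoʳ-≤ k (ℕₚ.^-monoʳ-≤ 2 exponent≤) ⟩
  k * 2 ^ ((5 + c) * suc d)                ≡⟨ cong (k *_) (ℕₚ.^-*-assoc 2 (5 + c) (suc d)) ⟨
  k * (2 ^ (5 + c)) ^ suc d                ≤⟨ ℕₚ.*-monoʳ-≤ k (ℕₚ.^-monoˡ-≤ (suc d) base≤) ⟩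
  k * ((2 ⊔ w) ^ 6) ^ suc d                ≡⟨ cong (k *_) (ℕₚ.^-*-assoc (2 ⊔ w) 6 (suc d)) ⟩
  k * (2 ⊔ w) ^ (6 * suc d)                ∎
  where
    open ℕₚ.≤-Reasoning

    exponent≤ : suc h ≤ (5 + c) * suc d
    exponent≤ = begin
      suc h                          ≤⟨ s≤s h≤ ⟩
      1 + suc d * (suc c + 3)        ≤⟨ ℕₚ.+-monoˡ-≤ _ (s≤s z≤n) ⟩
      suc d + suc d * (suc c + 3)    ≡⟨ ℕₚ.*-suc (suc d) (suc c + 3) ⟨
      suc d * suc (suc c + 3)        ≡⟨ ℕₚ.*-comm (suc d) _ ⟩
      suc (suc c + 3) * suc d        ≡⟨ cong (_* suc d) (cong (suc ∘ suc) (ℕₚ.+-comm c 3)) ⟩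
      (5 + c) * suc d                ∎

    base≤ : 2 ^ (5 + c) ≤ (2 ⊔ w) ^ 6
    base≤ = begin
      2 ^ (5 + c)            ≡⟨ ℕₚ.^-distribˡ-+-* 2 5 c ⟩
      2 ^ 5 * 2 ^ c          ≤⟨ ℕₚ.*-mono-≤ (ℕₚ.^-monoˡ-≤ 5 (ℕₚ.m≤m⊔n 2 w)) (ℕₚ.≤-trans 2^c≤w (ℕₚ.m≤n⊔m 2 w)) ⟩
      (2 ⊔ w) ^ 5 * (2 ⊔ w)  ≡⟨ ℕₚ.*-comm ((2 ⊔ w) ^ 5) (2 ⊔ w) ⟩
      (2 ⊔ w) ^ 6            ∎

-- Two distant vertices

module _ {H : List Point} {k l : ℕ} (inc : StrictlyIncX H) (hor : Horton H)
  (2≤l : 2 ≤ l) (l<k : l < suc (suc k)) (k≤n : suc (suc k) ≤ length H) where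

  private
    n = length H
    K = suc (suc k)

    first : Subset n
    first = window n 0 0 K

    first-vertex : Vertex H K first
    first-vertex = window-vertex inc hor 0 0 k (λ m<K → ℕₚ.<-≤-trans m<K k≤n)

    0<n : 0 < n
    0<n = ℕₚ.<-≤-trans z<s k≤n

    zero∈first : fromℕ< 0<n Sub.∈ first
    zero∈first = ∈-window⁺ 0 0 K z<s (Finₚ.toℕ-fromℕ< 0<n)

  -- A shorter walk would leave the last vertex at depth 1, among the odd indices, yet it contains
  -- index 0.
  walk-length : ∀ {h c d A} → K ∸ l < 2 ^ c → (∀ {i} → i Sub.∈ A → InClass h (toℕ i)) →
    Walk H K l d A first → h ≤ d * (c + 3)
  walk-length {h} {c} {d} w< A⊆ walk = ℕₚ.≮⇒≥ λ d< → impossible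
    (walk-class inc hor {c = c} 2≤l w< 1 walk
      (λ i∈A → InClass-mono (subst (_≤ h) (ℕₚ.+-comm 1 (d * (c + 3))) d<) (A⊆ i∈A)) zero∈first)
    where
      impossible : InClass 1 (toℕ (fromℕ< 0<n)) → _
      impossible (m , eq) = contradiction (trans (sym (Finₚ.toℕ-fromℕ< 0<n)) eq) λ ()

  -- At depth 0 a window with start 0 would be `first` itself, so for `n < 2 * K` the rightmost
  -- window is taken instead. Otherwise the start 0 at depth `suc h` fits by `at-bound`.
  far-vertices : Σ (Subset n) λ A → Σ (Subset n) λ B → Vertex H K A × Vertex H K B ×
    (∀ d → Walk H K l d A B → n ≤ K * ((2 ⊔ (K ∸ l)) ^ (6 * d)))
  far-vertices with bracket 1 (K ∸ l) ℕₚ.≤-refl (ℕₚ.m<n⇒0<n∸m l<k) | bracket K n (s≤s z≤n) k≤n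
  ... | c , 2^c≤w , w<2^1+c | zero , _ , n< =
    window n 0 (n ∸ K) K , first , window-vertex inc hor 0 (n ∸ K) k fits , first-vertex , bound
    where
      fits : ∀ {m} → m < K → n ∸ K + m < n
      fits {m} m<K = subst (n ∸ K + m <_) (ℕₚ.m∸n+n≡m k≤n) (ℕₚ.+-monoʳ-< (n ∸ K) m<K)

      n≤K : fromℕ< 0<n Sub.∈ window n 0 (n ∸ K) K → n ≤ K
      n≤K 0∈ with ∈-window⁻ 0 (n ∸ K) K 0∈
      ... | m , _ , 0≡ = ℕₚ.m∸n≡0⇒m≤n
        (ℕₚ.m+n≡0⇒m≡0 (n ∸ K) (trans (sym 0≡) (Finₚ.toℕ-fromℕ< 0<n)))

      bound : ∀ d → Walk H K l d (window n 0 (n ∸ K) K) first → n ≤ K * ((2 ⊔ (K ∸ l)) ^ (6 * d))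
      -- An empty walk identifies the two windows; the rightmost one then contains index 0, which
      -- forces `n ≤ K`.
      bound zero    walk = subst (n ≤_) (sym (ℕₚ.*-identityʳ K)) (n≤K (last∋0 walk))
        where
          last∋0 : ∀ {A} → Walk H K l 0 A first → fromℕ< 0<n Sub.∈ A
          last∋0 here = zero∈first
      -- Here `n < 2 * K`, so a single edge already pays for the bound.
      bound (suc d) _    = distance-bound {K} {n} {0} {c} d (subst (_≤ K ∸ l) (ℕₚ.*-identityˡ _) 2^c≤w) n< z≤n
  ... | c , 2^c≤w , w<2^1+c | suc h , K2^h≤n , n< =
    window n (suc h) 0 K , first , window-vertex inc hor (suc h) 0 k fits , first-vertex , bound
    where
      fits : ∀ {m} → m < K → at (suc h) m < n
      fits {m} m<K = begin-strict
        at (suc h) m         <⟨ at-bound (suc h) m ⟩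
        2 ^ suc h * suc m    ≤⟨ ℕₚ.*-monoʳ-≤ (2 ^ suc h) m<K ⟩
        2 ^ suc h * K        ≡⟨ ℕₚ.*-comm (2 ^ suc h) K ⟩
        K * 2 ^ suc h        ≤⟨ K2^h≤n ⟩
        n                    ∎
        where open ℕₚ.≤-Reasoning

      deep : ∀ {i} → i Sub.∈ window n (suc h) 0 K → InClass (suc h) (toℕ i)
      deep i∈ with ∈-window⁻ (suc h) 0 K i∈
      ... | m , _ , i≡ = m , i≡

      length≥ : ∀ {d} → Walk H K l d (window n (suc h) 0 K) first → suc h ≤ d * (suc c + 3)
      -- The strict bound on `K ∸ l` holds for exponent `suc c`; `c` itself serves only as the lower
      -- estimate in `distance-bound`.
      length≥ = walk-length {c = suc c} (subst (K ∸ l <_) (ℕₚ.*-identityˡ _) w<2^1+c) deep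

      bound : ∀ d → Walk H K l d (window n (suc h) 0 K) first → n ≤ K * ((2 ⊔ (K ∸ l)) ^ (6 * d))
      bound zero    walk = contradiction (length≥ walk) λ ()
      bound (suc d) walk = distance-bound {K} {n} {suc h} {c} d
        (subst (_≤ K ∸ l) (ℕₚ.*-identityˡ _) 2^c≤w) n< (length≥ walk)

-- In logarithms, every walk from `A` to `B` has length at least (log n - log k) / (q log max(2, k -
-- l)). The exponential form avoids real numbers, and the maximum avoids division by log 1.
theorem13 : Σ ℕ λ q → 1 ≤ q ×
    (∀ (H : List Point) (k l : ℕ) → StrictlyIncX H → Horton H →
    2 ≤ l → l < k → k ≤ length H →
    Σ (Subset (length H)) λ A → Σ (Subset (length H)) λ B → Vertex H k A × Vertex H k B ×
    (∀ d → Walk H k l d A B → length H ≤ k * ((2 ⊔ (k ∸ l)) ^ (q * d))))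
theorem13 = 6 , s≤s z≤n , bound
  where
    bound : ∀ (H : List Point) (k l : ℕ) → StrictlyIncX H → Horton H →
      2 ≤ l → l < k → k ≤ length H →
      Σ (Subset (length H)) λ A → Σ (Subset (length H)) λ B → Vertex H k A × Vertex H k B ×
      (∀ d → Walk H k l d A B → length H ≤ k * ((2 ⊔ (k ∸ l)) ^ (6 * d)))
    bound H (suc (suc k)) l   inc hor 2≤l l<k k≤n = far-vertices inc hor 2≤l l<k k≤n
    bound H (suc zero) (suc l) inc hor 2≤l (s≤s ()) k≤n
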